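{- Let $z$ be an integer with $z>2$. The average path length $\overline{D_t}$ of $G_t^z$ satisfies $$\lim_{t\to\infty}\frac{\overline{D_t}}{t}=\frac{4(z-1)}{z^{2}}.$$
   Context: Fix an integer $z>2$. The finite simple graphs $G_t^z$ ($t=0,1,2,\dots$), each with a distinguished vertex called its root (its largest, original hub node) and a distinguished set of vertices called its last-layer bottom nodes, are defined recursively. $G_0^z$ is a triangle; one of its vertices is the root (hub node) and the other two are its (last-layer) bottom nodes. For $t\ge1$, $G_t^z$ is formed from the disjoint union of $z$ copies of $G_{t-1}^z$, one called the original and the other $z-1$ called replicas, by adding an edge from the root of the original copy to every last-layer bottom node of each of the $z-1$ replicas. The root of $G_t^z$ is the root of the original copy, and the last-layer bottom nodes of $G_t^z$ are the last-layer bottom nodes of all $z-1$ replicas. Let $N_t=3z^t$ be the number of vertices of $G_t^z$ and let $D_t$ be the sum of the shortest-path distances over all unordered pairs of distinct vertices of $G_t^z$. The average path length is $\overline{D_t}=\frac{D_t}{N_t(N_t-1)/2}$. -}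

module Defs where

open import Data.Empty using (⊥)
open import Data.Fin.Base as Fin using (Fin)
import Data.Fin.Properties as Fin
open import Data.Integer.Base using (+_)
open import Data.List.Base using (List; []; _∷_; _++_; map; length; allFin; cartesianProductWith)
open import Data.List.Membership.Propositional using (_∈_; lose; find)
open import Data.List.Membership.Propositional.Properties
  using (∈-map⁺; ∈-map⁻; ∈-++⁺ˡ; ∈-++⁺ʳ; ∈-allFin; ∈-cartesianProductWith⁺; ∈-cartesianProductWith⁻)
open import Data.List.Properties using (length-++; length-map; length-tabulate)
open import Data.List.Relation.Unary.Any using (any?)
open import Data.List.Relation.Unary.Unique.Propositional using (Unique)
import Data.List.Relation.Unary.Unique.Propositional.Properties as Unique
open import Data.Nat.Base as ℕ using (ℕ; zero; suc; _∸_; z≤n; s≤s)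
open import Data.Nat.ListAction using (sum)
import Data.Nat.Properties as ℕ
open import Data.Product.Base using (∃; _×_; _,_; proj₁; proj₂)
open import Data.Rational.Unnormalised.Base using (ℚᵘ; 0ℚᵘ; _/_; _÷_; _-_; _<_; ∣_∣)
open import Function.Base using (_∘_; case_of_)
open import Relation.Binary.Definitions using (DecidableEquality)
open import Relation.Binary.PropositionalEquality using (_≡_; _≢_; refl; sym; trans; cong; cong₂)
open import Relation.Nullary using (¬_; Dec; yes; no; contradiction)
open import Relation.Nullary.Decidable using (map′; _×-dec_; ¬?)

record FiniteSimpleGraph : Set₁ where
  infix 4 _~_ _~?_ _≟_
  field
    Vertex   : Set
    _≟_      : DecidableEquality Vertex
    vertices : List Vertex
    complete : ∀ v → v ∈ vertices
    unique   : Unique vertices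
    _~_      : Vertex → Vertex → Set
    _~?_     : ∀ u v → Dec (u ~ v)
    ~-sym    : ∀ u v → u ~ v → v ~ u
    ~-irrefl : ∀ v → ¬ v ~ v

  data Walk : Vertex → Vertex → ℕ → Set where
    []  : ∀ {v} → Walk v v 0
    _∷_ : ∀ {u v w k} → u ~ v → Walk v w k → Walk u w (suc k)

  _++ʷ_ : ∀ {u v w k l} → Walk u v k → Walk v w l → Walk u w (k ℕ.+ l)
  []      ++ʷ q = q
  (e ∷ p) ++ʷ q = e ∷ (p ++ʷ q)

  Connected : Set
  Connected = ∀ u v → ∃ (Walk u v)

  IsDistance : Vertex → Vertex → ℕ → Set
  IsDistance u v d = Walk u v d × (∀ k → Walk u v k → d ℕ.≤ k)

  walk? : ∀ u v k → Dec (Walk u v k)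
  walk? u v zero    = map′ (λ { refl → [] }) (λ { [] → refl }) (u ≟ v)
  walk? u v (suc k) =
    map′ (λ a → case find a of λ { (_ , _ , e , p) → e ∷ p })
         (λ { (e ∷ p) → lose (complete _) (e , p) })
         (any? (λ w → (u ~? w) ×-dec walk? w v k) vertices)

least : {P : ℕ → Set} → (∀ n → Dec (P n)) → ∀ n → P n → ∃ λ m → P m × (∀ k → P k → m ℕ.≤ k)
least P? zero    p = 0 , p , λ _ _ → z≤n
least P? (suc n) p with P? 0
... | yes p₀ = 0 , p₀ , λ _ _ → z≤n
... | no ¬p₀ with least (λ k → P? (suc k)) n p
...   | m , pₘ , min = suc m , pₘ , λ { zero p₀ → contradiction p₀ ¬p₀ ; (suc k) pₖ → s≤s (min k pₖ) }

-- Adds f x y over all x occurring strictly before y in the list.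
sumPairs : {A : Set} → (A → A → ℕ) → List A → ℕ
sumPairs f []       = 0
sumPairs f (x ∷ xs) = sum (map (f x) xs) ℕ.+ sumPairs f xs

module Distance (G : FiniteSimpleGraph) (connected : FiniteSimpleGraph.Connected G) where
  open FiniteSimpleGraph G

  shortest : ∀ u v → ∃ (IsDistance u v)
  shortest u v = let k , p = connected u v in least (walk? u v) k p

  dist : Vertex → Vertex → ℕ
  dist u v = proj₁ (shortest u v)

  -- The list of vertices is complete and duplicate-free and dist is symmetric, so each
  -- unordered pair of distinct vertices contributes exactly once.
  totalDistance : ℕ
  totalDistance = sumPairs dist vertices

record HubGraph : Set₁ where
  field
    graph : FiniteSimpleGraph
  open FiniteSimpleGraph graph public
  field
    root    : Vertex
    Bottom  : Vertex → Set
    bottom? : ∀ v → Dec (Bottom v)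

triangle : HubGraph
triangle = record
  { graph = record
    { Vertex   = Fin 3
    ; _≟_      = Fin._≟_
    ; vertices = allFin 3
    ; complete = ∈-allFin
    ; unique   = Unique.allFin⁺ 3
    ; _~_      = _≢_
    ; _~?_     = λ u v → ¬? (u Fin.≟ v)
    ; ~-sym    = λ _ _ u≢v → u≢v ∘ sym
    ; ~-irrefl = λ _ v≢v → v≢v refl
    }
  ; root    = Fin.zero
  ; Bottom  = _≢ Fin.zero
  ; bottom? = λ v → ¬? (v Fin.≟ Fin.zero)
  }

data Copies (r : ℕ) (V : Set) : Set where
  original : V → Copies r V
  replica  : Fin r → V → Copies r V

-- The original and r replicas; r = z - 1 below.
module Step (r : ℕ) (H : HubGraph) where
  open HubGraph H

  infix 4 _~′_ _~′?_ _≟′_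

  V′ : Set
  V′ = Copies r Vertex

  _≟′_ : DecidableEquality V′
  original u  ≟′ original v  = map′ (cong original) (λ { refl → refl }) (u ≟ v)
  original _  ≟′ replica _ _ = no λ ()
  replica _ _ ≟′ original _  = no λ ()
  replica i u ≟′ replica j v =
    map′ (λ { (refl , refl) → refl }) (λ { refl → refl , refl }) ((i Fin.≟ j) ×-dec (u ≟ v))

  _~′_ : V′ → V′ → Set
  original u  ~′ original v  = u ~ v
  original u  ~′ replica _ v = u ≡ root × Bottom v
  replica _ u ~′ original v  = v ≡ root × Bottom u
  replica i u ~′ replica j v = i ≡ j × u ~ v

  _~′?_ : ∀ u v → Dec (u ~′ v)
  original u  ~′? original v  = u ~? v
  original u  ~′? replica _ v = (u ≟ root) ×-dec bottom? v
  replica _ u ~′? original v  = (v ≟ root) ×-dec bottom? u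
  replica i u ~′? replica j v = (i Fin.≟ j) ×-dec (u ~? v)

  ~′-sym : ∀ u v → u ~′ v → v ~′ u
  ~′-sym (original u)  (original v)  e       = ~-sym u v e
  ~′-sym (original _)  (replica _ _) e       = e
  ~′-sym (replica _ _) (original _)  e       = e
  ~′-sym (replica _ u) (replica _ v) (p , e) = sym p , ~-sym u v e

  ~′-irrefl : ∀ v → ¬ v ~′ v
  ~′-irrefl (original v)  e       = ~-irrefl v e
  ~′-irrefl (replica _ v) (_ , e) = ~-irrefl v e

  vertices′ : List V′
  vertices′ = map original vertices ++ cartesianProductWith replica (allFin r) vertices

  complete′ : ∀ v → v ∈ vertices′
  complete′ (original v)  = ∈-++⁺ˡ (∈-map⁺ original (complete v))
  complete′ (replica i v) =
    ∈-++⁺ʳ (map original vertices) (∈-cartesianProductWith⁺ replica (∈-allFin i) (complete v))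

  unique′ : Unique vertices′
  unique′ = Unique.++⁺
    (Unique.map⁺ (λ { refl → refl }) unique)
    (Unique.cartesianProductWith⁺ replica (λ { refl → refl , refl }) (Unique.allFin⁺ r) unique)
    disjoint
    where
    disjoint : ∀ {v} → ¬ (v ∈ map original vertices × v ∈ cartesianProductWith replica (allFin r) vertices)
    disjoint (p , q)
      with ∈-map⁻ original p | ∈-cartesianProductWith⁻ replica (allFin r) vertices q
    ... | _ , _ , refl | _ , _ , _ , _ , ()

  Bottom′ : V′ → Set
  Bottom′ (original _)  = ⊥
  Bottom′ (replica _ v) = Bottom v

  bottom′? : ∀ v → Dec (Bottom′ v)
  bottom′? (original _)  = no λ ()
  bottom′? (replica _ v) = bottom? v

  graph′ : FiniteSimpleGraph
  graph′ = record
    { Vertex   = V′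
    ; _≟_      = _≟′_
    ; vertices = vertices′
    ; complete = complete′
    ; unique   = unique′
    ; _~_      = _~′_
    ; _~?_     = _~′?_
    ; ~-sym    = ~′-sym
    ; ~-irrefl = ~′-irrefl
    }

  step : HubGraph
  step = record
    { graph   = graph′
    ; root    = original root
    ; Bottom  = Bottom′
    ; bottom? = bottom′?
    }

  module G′ = FiniteSimpleGraph graph′

  originalWalk : ∀ {u v k} → Walk u v k → G′.Walk (original u) (original v) k
  originalWalk []      = G′.[]
  originalWalk (e ∷ p) = e G′.∷ originalWalk p

  replicaWalk : ∀ {u v k} i → Walk u v k → G′.Walk (replica i u) (replica i v) k
  replicaWalk i []      = G′.[]
  replicaWalk i (e ∷ p) = (refl , e) G′.∷ replicaWalk i p

  connected′ : (Fin r → ∃ Bottom) → Connected → G′.Connected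
  connected′ someBottom connected u v = _ , proj₂ (toRoot u) G′.++ʷ proj₂ (fromRoot v)
    where
    toRoot : ∀ u → ∃ (G′.Walk u (original root))
    toRoot (original u)  = _ , originalWalk (proj₂ (connected u root))
    toRoot (replica i u) =
      let b , β = someBottom i
      in  _ , replicaWalk i (proj₂ (connected u b)) G′.++ʷ ((refl , β) G′.∷ G′.[])
    fromRoot : ∀ v → ∃ (G′.Walk (original root) v)
    fromRoot (original v)  = _ , originalWalk (proj₂ (connected root v))
    fromRoot (replica i v) =
      let b , β = someBottom i
      in  _ , (refl , β) G′.∷ replicaWalk i (proj₂ (connected b v))

G : ℕ → ℕ → HubGraph
G z zero    = triangle
G z (suc t) = Step.step (z ∸ 1) (G z t)

someBottom : ∀ z t → Fin (z ∸ 1) → ∃ (HubGraph.Bottom (G z t))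
someBottom z zero    i = Fin.suc Fin.zero , λ ()
someBottom z (suc t) i = let b , β = someBottom z t i in replica i b , β

module Triangle = HubGraph triangle

triangle-connected : Triangle.Connected
triangle-connected u v with u Fin.≟ v
... | yes refl = 0 , Triangle.[]
... | no u≢v   = 1 , u≢v Triangle.∷ Triangle.[]

connected : ∀ z t → HubGraph.Connected (G z t)
connected z zero    = triangle-connected
connected z (suc t) = Step.connected′ (z ∸ 1) (G z t) (someBottom z t) (connected z t)

N : ℕ → ℕ → ℕ
N z t = 3 ℕ.* z ℕ.^ t

D : ℕ → ℕ → ℕ
D z t = Distance.totalDistance (HubGraph.graph (G z t)) (connected z t)

length-cartesianProductWith : {A B C : Set} (f : A → B → C) (xs : List A) (ys : List B) →
  length (cartesianProductWith f xs ys) ≡ length xs ℕ.* length ys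
length-cartesianProductWith f []       ys = refl
length-cartesianProductWith f (x ∷ xs) ys =
  trans (length-++ (map (f x) ys))
        (cong₂ ℕ._+_ (length-map (f x) ys) (length-cartesianProductWith f xs ys))

length-vertices : ∀ z → 2 ℕ.< z → ∀ t → length (HubGraph.vertices (G z t)) ≡ N z t
length-vertices z       z>2 zero    = refl
length-vertices (suc r) z>2 (suc t) = begin
  length (map original vs ++ cartesianProductWith replica (allFin r) vs)
    ≡⟨ length-++ (map original vs) ⟩
  length (map original vs) ℕ.+ length (cartesianProductWith replica (allFin r) vs)
    ≡⟨ cong₂ ℕ._+_ (length-map original vs)
         (trans (length-cartesianProductWith replica (allFin r) vs)
                (cong (ℕ._* length vs) (length-tabulate {n = r} (λ i → i)))) ⟩
  suc r ℕ.* length vs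
    ≡⟨ cong (suc r ℕ.*_) (length-vertices (suc r) z>2 t) ⟩
  suc r ℕ.* (3 ℕ.* suc r ℕ.^ t)
    ≡⟨ ℕ.*-assoc (suc r) 3 (suc r ℕ.^ t) ⟨
  (suc r ℕ.* 3) ℕ.* suc r ℕ.^ t
    ≡⟨ cong (ℕ._* suc r ℕ.^ t) (ℕ.*-comm (suc r) 3) ⟩
  (3 ℕ.* suc r) ℕ.* suc r ℕ.^ t
    ≡⟨ ℕ.*-assoc 3 (suc r) (suc r ℕ.^ t) ⟩
  3 ℕ.* (suc r ℕ.* suc r ℕ.^ t) ∎
  where
  open Relation.Binary.PropositionalEquality.≡-Reasoning
  vs = HubGraph.vertices (G (suc r) t)

z^n≢0 : ∀ {z} → 2 ℕ.< z → ∀ n → ℕ.NonZero (z ℕ.^ n)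
z^n≢0 {suc r} _ n = ℕ.m^n≢0 (suc r) n

N[N-1]≢0 : ∀ {z} → 2 ℕ.< z → ∀ t → ℕ.NonZero (N z t ℕ.* (N z t ∸ 1))
N[N-1]≢0 {z} z>2 t with z ℕ.^ t | z^n≢0 z>2 t
... | suc k | _ = ℕ.m*n≢0 (3 ℕ.* suc k) (3 ℕ.* suc k ∸ 1) {{ℕ.m*n≢0 3 (suc k)}} {{positive}}
  where
  positive : ℕ.NonZero (3 ℕ.* suc k ∸ 1)
  positive rewrite ℕ.+-suc k (k ℕ.+ (suc k ℕ.+ 0)) = _

averagePathLength : (z : ℕ) → 2 ℕ.< z → ℕ → ℚᵘ
averagePathLength z z>2 t =
  _÷_ (+ D z t / 1) (+ (N z t ℕ.* (N z t ∸ 1)) / 2) {{N[N-1]≢0 z>2 t}}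

-- Sequences indexed by t ≥ 1.  For a rational sequence with rational limit, testing only
-- rational ε > 0 is equivalent to testing all real ε > 0.
_⟶_ : ((t : ℕ) → .{{ℕ.NonZero t}} → ℚᵘ) → ℚᵘ → Set
a ⟶ ℓ = ∀ ε → 0ℚᵘ < ε → ∃ λ T → ∀ t → .{{_ : ℕ.NonZero t}} → T ℕ.≤ t → ∣ a t - ℓ ∣ < ε

{-# OPTIONS --safe #-}
module Submission where

-- Every bottom node is adjacent to the root, so two vertices of one replica gain nothing
-- from a detour through the root of the original copy.  Hence distances within a copy are
-- those of G t, and all others are sums of distances to the root and distances β to the
-- bottom nodes in G t.  With h, b and d the sums of the root distances, of β and of all
-- pairwise distances, this gives a linear recursion for (h, b) and
-- d (t + 1) = z d t + (z - 1) N h (t + 1), so z² d t = 18 (z - 1) t z^(2t) + O(z^(2t)).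

open import Defs
open import Data.Fin.Base as Fin using (Fin)
import Data.Fin.Properties as Fin
open import Data.List.Base using (List; []; _∷_; _++_; map; length; allFin; cartesianProductWith)
open import Data.List.Properties using (map-++; map-∘; map-cong; length-tabulate)
open import Data.List.Relation.Unary.All as All using (All; []; _∷_)
open import Data.List.Relation.Unary.AllPairs using ([]; _∷_)
open import Data.List.Relation.Unary.Unique.Propositional using (Unique)
import Data.List.Relation.Unary.Unique.Propositional.Properties as Unique
open import Data.Nat.Base as ℕ using (ℕ; zero; suc; _∸_; _+_; _*_; _^_; _≤_; z≤n; s≤s)
open import Data.Nat.ListAction using (sum)
open import Data.Nat.ListAction.Properties using (sum-++)
open import Data.Nat.Properties
open import Data.Nat.Tactic.RingSolver using (solve-∀)
open import Data.Integer.Base as ℤ using (+_)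
import Data.Integer.Properties as ℤ
open import Data.Product.Base using (∃; _×_; _,_; proj₁; proj₂)
open import Data.Rational.Unnormalised.Base as ℚ using (_/_; _÷_)
open import Function.Base using (_∘_)
open import Relation.Binary.PropositionalEquality
open import Relation.Nullary using (Dec; yes; no; contradiction)

-- Walks and distances in a graph.

module _ (𝔾 : FiniteSimpleGraph) where
  open FiniteSimpleGraph 𝔾

  reverse : ∀ {u v k} → Walk u v k → Walk v u k
  reverse p = subst (Walk _ _) (+-identityʳ _) (onto p [])
    where
    onto : ∀ {u v w k l} → Walk u v k → Walk u w l → Walk v w (k + l)
    onto             []            q = q
    onto {k = suc k} {l} (e ∷ p) q = subst (Walk _ _) (+-suc k l) (onto p (~-sym _ _ e ∷ q))

  -- Gives lower bounds for distances without analysing how walks cross between copies: if `φ`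
  -- vanishes at the end of a walk, its length is at least `φ` at the start.
  walk-lipschitz : (φ : Vertex → ℕ) → (∀ {u v} → u ~ v → φ u ≤ suc (φ v)) →
    ∀ {u v k} → Walk u v k → φ u ≤ k + φ v
  walk-lipschitz φ lip []      = ≤-refl
  walk-lipschitz φ lip (e ∷ p) = ≤-trans (lip e) (s≤s (walk-lipschitz φ lip p))

  isDistance-unique : ∀ {u v d d′} → IsDistance u v d → IsDistance u v d′ → d ≡ d′
  isDistance-unique (p , min) (p′ , min′) = ≤-antisym (min _ p′) (min′ _ p)

-- Sums over lists and over unordered pairs.

private variable A B I : Set

∑ : List A → (A → ℕ) → ℕ
∑ xs f = sum (map f xs)

∑-cong : ∀ {f g : A → ℕ} xs → (∀ x → f x ≡ g x) → ∑ xs f ≡ ∑ xs g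
∑-cong xs f≗g = cong sum (map-cong f≗g xs)

∑-++ : ∀ (f : A → ℕ) xs ys → ∑ (xs ++ ys) f ≡ ∑ xs f + ∑ ys f
∑-++ f xs ys = trans (cong sum (map-++ f xs ys)) (sum-++ (map f xs) (map f ys))

∑-map : ∀ (f : B → ℕ) (g : A → B) xs → ∑ (map g xs) f ≡ ∑ xs (f ∘ g)
∑-map f g xs = cong sum (sym (map-∘ xs))

∑-const-+ : ∀ c (f : A → ℕ) xs → ∑ xs (λ x → c + f x) ≡ length xs * c + ∑ xs f
∑-const-+ c f []       = refl
∑-const-+ c f (x ∷ xs) rewrite ∑-const-+ c f xs = lemma c (f x) (length xs * c) (∑ xs f)
  where
  lemma : ∀ a b c d → a + b + (c + d) ≡ a + c + (b + d)
  lemma = solve-∀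

∑-suc : ∀ (f : A → ℕ) xs → ∑ xs (suc ∘ f) ≡ length xs + ∑ xs f
∑-suc f xs = trans (∑-const-+ 1 f xs) (cong (ℕ._+ ∑ xs f) (*-identityʳ (length xs)))

∑-* : ∀ c (f : A → ℕ) xs → ∑ xs (λ x → c * f x) ≡ c * ∑ xs f
∑-* c f []       = sym (*-zeroʳ c)
∑-* c f (x ∷ xs) rewrite ∑-* c f xs = sym (*-distribˡ-+ c (f x) (∑ xs f))

-- The distance between vertices of different copies has one term per endpoint, so every block of
-- such pairs is evaluated by this identity.
∑∑-+ : ∀ (f : A → ℕ) (g : B → ℕ) xs ys →
  ∑ xs (λ x → ∑ ys (λ y → f x + g y)) ≡ length ys * ∑ xs f + length xs * ∑ ys g
∑∑-+ f g xs ys = begin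
  ∑ xs (λ x → ∑ ys (λ y → f x + g y))           ≡⟨ ∑-cong xs (λ x → trans (∑-const-+ (f x) g ys) (+-comm _ (∑ ys g))) ⟩
  ∑ xs (λ x → ∑ ys g + length ys * f x)         ≡⟨ ∑-const-+ (∑ ys g) (λ x → length ys * f x) xs ⟩
  length xs * ∑ ys g + ∑ xs (λ x → length ys * f x) ≡⟨ cong (length xs * ∑ ys g ℕ.+_) (∑-* (length ys) f xs) ⟩
  length xs * ∑ ys g + length ys * ∑ xs f       ≡⟨ +-comm (length xs * ∑ ys g) _ ⟩
  length ys * ∑ xs f + length xs * ∑ ys g       ∎
  where open ≡-Reasoning

sumPairs-cong : ∀ {f g : A → A → ℕ} xs → (∀ x y → f x y ≡ g x y) → sumPairs f xs ≡ sumPairs g xs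
sumPairs-cong []       f≗g = refl
sumPairs-cong (x ∷ xs) f≗g = cong₂ _+_ (∑-cong xs (f≗g x)) (sumPairs-cong xs f≗g)

sumPairs-++ : ∀ (f : A → A → ℕ) xs ys →
  sumPairs f (xs ++ ys) ≡ sumPairs f xs + sumPairs f ys + ∑ xs (λ x → ∑ ys (f x))
sumPairs-++ f []       ys = sym (+-identityʳ _)
sumPairs-++ f (x ∷ xs) ys rewrite ∑-++ (f x) xs ys | sumPairs-++ f xs ys =
  lemma (∑ xs (f x)) (∑ ys (f x)) (sumPairs f xs) (sumPairs f ys) (∑ xs (λ x → ∑ ys (f x)))
  where
  lemma : ∀ a b c d e → a + b + (c + d + e) ≡ a + c + d + (b + e)
  lemma = solve-∀

sumPairs-map : ∀ (f : B → B → ℕ) (g : A → B) xs →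
  sumPairs f (map g xs) ≡ sumPairs (λ x y → f (g x) (g y)) xs
sumPairs-map f g []       = refl
sumPairs-map f g (x ∷ xs) = cong₂ _+_ (∑-map (f (g x)) g xs) (sumPairs-map f g xs)

-- The hypothesis ranges over the listed indices only, so that a block of replicas can exclude the
-- one containing the other endpoint.
∑-cartesianProductWith : ∀ (f : B → ℕ) (g : I → A → B) {h : A → ℕ} {is} xs →
  All (λ i → ∀ x → f (g i x) ≡ h x) is →
  ∑ (cartesianProductWith g is xs) f ≡ length is * ∑ xs h
∑-cartesianProductWith f g xs [] = refl
∑-cartesianProductWith f g {is = i ∷ is} xs (e ∷ es) =
  trans (∑-++ f (map (g i) xs) (cartesianProductWith g is xs))
    (cong₂ _+_ (trans (∑-map f (g i) xs) (∑-cong xs e)) (∑-cartesianProductWith f g xs es))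

-- Distance functions on hub graphs.

-- δ is the distance function and β the distance to the set of bottom nodes; being
-- Lipschitz along edges makes them lower bounds for walk lengths.
record HubMetric (H : HubGraph) : Set where
  open HubGraph H
  field
    δ           : Vertex → Vertex → ℕ
    δ-walk      : ∀ u v → Walk u v (δ u v)
    δ-refl      : ∀ v → δ v v ≡ 0
    δ-lipschitz : ∀ w {u v} → u ~ v → δ u w ≤ suc (δ v w)
    β           : Vertex → ℕ
    β-walk      : ∀ u → ∃ λ b → Bottom b × Walk u b (β u)
    β-bottom    : ∀ {b} → Bottom b → β b ≡ 0
    β-lipschitz : ∀ {u v} → u ~ v → β u ≤ suc (β v)
    bottom~root : ∀ {b} → Bottom b → b ~ root

  δ-minimal : ∀ {u v k} → Walk u v k → δ u v ≤ k
  δ-minimal {u} {v} {k} p = begin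
    δ u v     ≤⟨ walk-lipschitz graph (λ w → δ w v) (δ-lipschitz v) p ⟩
    k + δ v v ≡⟨ cong (k ℕ.+_) (δ-refl v) ⟩
    k + 0     ≡⟨ +-identityʳ k ⟩
    k         ∎
    where open ≤-Reasoning

  δ-isDistance : ∀ u v → IsDistance u v (δ u v)
  δ-isDistance u v = δ-walk u v , λ _ → δ-minimal

  -- `β` is Lipschitz and zero at `b`. Together with the next bound, this compares staying inside a
  -- replica with the route over the original root.
  β≤δ-bottom : ∀ {b} v → Bottom b → β v ≤ δ b v
  β≤δ-bottom {b} v bot = begin
    β v         ≤⟨ walk-lipschitz graph β β-lipschitz (reverse graph (δ-walk b v)) ⟩
    δ b v + β b ≡⟨ cong (δ b v ℕ.+_) (β-bottom bot) ⟩
    δ b v + 0   ≡⟨ +-identityʳ _ ⟩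
    δ b v       ∎
    where open ≤-Reasoning

  -- Walk from `b` to the root, on to the bottom node nearest to `v`, then to `v`. A detour over the
  -- root of the original copy has this same length.
  δ-bottom≤2+β : ∀ {b} v → Bottom b → δ b v ≤ suc (suc (β v))
  δ-bottom≤2+β v bot = let b′ , bot′ , p = β-walk v in
    δ-minimal (bottom~root bot ∷ (~-sym _ _ (bottom~root bot′) ∷ reverse graph p))

  rootSum bottomSum pairSum : ℕ
  rootSum   = ∑ vertices (λ v → δ v root)
  bottomSum = ∑ vertices β
  pairSum   = sumPairs δ vertices

  totalDistance≡pairSum : ∀ conn → Distance.totalDistance graph conn ≡ pairSum
  totalDistance≡pairSum conn = sumPairs-cong vertices λ u v →
    isDistance-unique graph (proj₂ (Distance.shortest graph conn u v)) (δ-isDistance u v)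

triangleMetric : HubMetric triangle
triangleMetric = record
  { δ           = λ u v → δ₀ (u Fin.≟ v)
  ; δ-walk      = λ u v → walk (u Fin.≟ v)
  ; δ-refl      = λ v → δ₀-refl (v Fin.≟ v)
  ; δ-lipschitz = λ w {u} {v} _ → ≤-trans (δ₀≤1 (u Fin.≟ w)) (s≤s z≤n)
  ; β           = β₀
  ; β-walk      = λ { Fin.zero → Fin.suc Fin.zero , (λ ()) , (λ ()) Triangle.∷ Triangle.[]
                    ; (Fin.suc i) → Fin.suc i , (λ ()) , Triangle.[] }
  ; β-bottom    = λ { {Fin.zero} b → contradiction refl b ; {Fin.suc _} _ → refl }
  ; β-lipschitz = λ { {Fin.zero} _ → s≤s z≤n ; {Fin.suc _} _ → z≤n }
  ; bottom~root = λ b → b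
  }
  where
  δ₀ : {u v : Fin 3} → Dec (u ≡ v) → ℕ
  δ₀ (yes _) = 0
  δ₀ (no _)  = 1
  walk : ∀ {u v} (d : Dec (u ≡ v)) → Triangle.Walk u v (δ₀ d)
  walk (yes refl) = Triangle.[]
  walk (no u≢v)   = u≢v Triangle.∷ Triangle.[]
  δ₀-refl : ∀ {v} (d : Dec (v ≡ v)) → δ₀ d ≡ 0
  δ₀-refl (yes _)  = refl
  δ₀-refl (no v≢v) = contradiction refl v≢v
  δ₀≤1 : ∀ {u v} (d : Dec (u ≡ v)) → δ₀ d ≤ 1
  δ₀≤1 (yes _) = z≤n
  δ₀≤1 (no _)  = s≤s z≤n
  β₀ : Fin 3 → ℕ
  β₀ Fin.zero    = 1
  β₀ (Fin.suc _) = 0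

-- Distances and their sums after one step.

module StepMetric (s : ℕ) {H : HubGraph} (M : HubMetric H) where
  open HubGraph H
  open HubMetric M
  open Step (suc s) H

  -- Taking the decision as an argument lets the proofs split on it directly, apart from the call to
  -- `Fin._≟_`.
  δʳ : {i j : Fin (suc s)} → Dec (i ≡ j) → Vertex → Vertex → ℕ
  δʳ (yes _) u v = δ u v
  δʳ (no _)  u v = suc (β u) + suc (β v)

  -- A replica is joined to the rest of the graph only by edges from its bottom nodes to the
  -- original root, so leaving it from `u` costs `suc (β u)`.
  δ′ : V′ → V′ → ℕ
  δ′ (original u)  (original v)  = δ u v
  δ′ (original u)  (replica _ v) = δ u root + suc (β v)
  δ′ (replica _ u) (original v)  = suc (β u) + δ root v
  δ′ (replica i u) (replica j v) = δʳ (i Fin.≟ j) u v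

  -- The new bottom nodes lie in the replicas, one edge from the original root; inside a replica the
  -- nearest one is unchanged.
  β′ : V′ → ℕ
  β′ (original u)  = suc (δ u root)
  β′ (replica _ u) = β u

  fromRoot : ∀ i v → G′.Walk (original root) (replica i v) (suc (β v))
  fromRoot i v = let b , bot , p = β-walk v in (refl , bot) G′.∷ replicaWalk i (reverse graph p)

  toRoot : ∀ i u → G′.Walk (replica i u) (original root) (suc (β u))
  toRoot i u = reverse graph′ (fromRoot i u)

  δʳ-walk : ∀ {i j} (d : Dec (i ≡ j)) u v → G′.Walk (replica i u) (replica j v) (δʳ d u v)
  δʳ-walk (yes refl) u v = replicaWalk _ (δ-walk u v)
  δʳ-walk (no _)     u v = toRoot _ u G′.++ʷ fromRoot _ v

  δ′-walk : ∀ u v → G′.Walk u v (δ′ u v)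
  δ′-walk (original u)  (original v)  = originalWalk (δ-walk u v)
  δ′-walk (original u)  (replica i v) = originalWalk (δ-walk u root) G′.++ʷ fromRoot i v
  δ′-walk (replica i u) (original v)  = toRoot i u G′.++ʷ originalWalk (δ-walk root v)
  δ′-walk (replica i u) (replica j v) = δʳ-walk (i Fin.≟ j) u v

  δʳ-diag : ∀ {i} (d : Dec (i ≡ i)) u v → δʳ d u v ≡ δ u v
  δʳ-diag (yes _)  u v = refl
  δʳ-diag (no i≢i) u v = contradiction refl i≢i

  δʳ-off : ∀ {i j} (d : Dec (i ≡ j)) → i ≢ j → ∀ u v → δʳ d u v ≡ suc (β u) + suc (β v)
  δʳ-off (yes i≡j) i≢j u v = contradiction i≡j i≢j
  δʳ-off (no _)    _   u v = refl

  δ′-refl : ∀ v → δ′ v v ≡ 0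
  δ′-refl (original v)  = δ-refl v
  δ′-refl (replica i v) = trans (δʳ-diag (i Fin.≟ i) v v) (δ-refl v)

  δʳ-lipschitz : ∀ {i j} (d : Dec (i ≡ j)) w {u v} → u ~ v → δʳ d u w ≤ suc (δʳ d v w)
  δʳ-lipschitz (yes _) w e = δ-lipschitz w e
  δʳ-lipschitz (no _)  w e = s≤s (+-monoˡ-≤ (suc (β w)) (β-lipschitz e))

  -- This is the edge from the original root to `b`. In the same replica `b` is a bottom node, so
  -- `β w` is at most `δ b w`; otherwise the route from `b` to `w` already passes through the root.
  root-lipschitz : ∀ {i j} (d : Dec (i ≡ j)) {b} w → Bottom b →
    δ root root + suc (β w) ≤ suc (δʳ d b w)
  root-lipschitz d {b} w bot rewrite δ-refl root with d
  ... | yes _ = s≤s (β≤δ-bottom w bot)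
  ... | no _  = m≤n⇒m≤1+n (m≤n+m (suc (β w)) (suc (β b)))

  -- The same edge in the other direction: in the same replica this is the detour bound; in another
  -- one `β b` is zero and both sides agree.
  bottom-lipschitz : ∀ {i j} (d : Dec (i ≡ j)) {b} w → Bottom b →
    δʳ d b w ≤ suc (δ root root + suc (β w))
  bottom-lipschitz d w bot rewrite δ-refl root with d
  ... | yes _ = δ-bottom≤2+β w bot
  ... | no _ rewrite β-bottom bot = ≤-refl

  δ′-lipschitz : ∀ w {u v} → u ~′ v → δ′ u w ≤ suc (δ′ v w)
  δ′-lipschitz (original w)  {original _}  {original _}  e            = δ-lipschitz w e
  δ′-lipschitz (original w)  {original _}  {replica _ v} (refl , bot) = ≤-trans (m≤n+m _ (suc (β v))) (n≤1+n _)
  δ′-lipschitz (original w)  {replica _ _} {original _}  (refl , bot) rewrite β-bottom bot = ≤-refl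
  δ′-lipschitz (original w)  {replica _ _} {replica _ _} (refl , e)   = s≤s (+-monoˡ-≤ (δ root w) (β-lipschitz e))
  δ′-lipschitz (replica j w) {original _}  {original _}  e            = +-monoˡ-≤ (suc (β w)) (δ-lipschitz root e)
  δ′-lipschitz (replica j w) {original _}  {replica i _} (refl , bot) = root-lipschitz (i Fin.≟ j) w bot
  δ′-lipschitz (replica j w) {replica i _} {original _}  (refl , bot) = bottom-lipschitz (i Fin.≟ j) w bot
  δ′-lipschitz (replica j w) {replica i _} {replica _ _} (refl , e)   = δʳ-lipschitz (i Fin.≟ j) w e

  β′-walk : ∀ u → ∃ λ b → Bottom′ b × G′.Walk u b (β′ u)
  β′-walk (replica i u)  = let b , bot , p = β-walk u in replica i b , bot , replicaWalk i p
  β′-walk (original u) = let b , bot , _ = β-walk root in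
    -- Any replica would serve; index zero exists because there are `suc s` of them.
    replica Fin.zero b , bot ,
    subst (G′.Walk _ _) (+-comm (δ u root) 1)
      (originalWalk (δ-walk u root) G′.++ʷ ((refl , bot) G′.∷ G′.[]))

  β′-bottom : ∀ {b} → Bottom′ b → β′ b ≡ 0
  β′-bottom {replica _ _} = β-bottom

  β′-lipschitz : ∀ {u v} → u ~′ v → β′ u ≤ suc (β′ v)
  β′-lipschitz {original _}  {original _}  e          = s≤s (δ-lipschitz root e)
  β′-lipschitz {original _}  {replica _ _} (refl , _) rewrite δ-refl root = s≤s z≤n
  β′-lipschitz {replica _ _} {original _}  (_ , bot)  rewrite β-bottom bot = z≤n
  β′-lipschitz {replica _ _} {replica _ _} (_ , e)    = β-lipschitz e

  stepMetric : HubMetric step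
  stepMetric = record
    { δ           = δ′
    ; δ-walk      = δ′-walk
    ; δ-refl      = δ′-refl
    ; δ-lipschitz = δ′-lipschitz
    ; β           = β′
    ; β-walk      = β′-walk
    ; β-bottom    = λ {b} → β′-bottom {b}
    ; β-lipschitz = λ {u} {v} → β′-lipschitz {u} {v}
    ; bottom~root = λ { {replica _ _} bot → refl , bot }
    }

  open HubMetric stepMetric using ()
    renaming (rootSum to rootSum′; bottomSum to bottomSum′; pairSum to pairSum′)

  private
    n = length vertices
    replicas = cartesianProductWith replica (allFin (suc s)) vertices

  ∑-replicas : ∀ (f : V′ → ℕ) {h} → (∀ i v → f (replica i v) ≡ h v) → ∑ replicas f ≡ suc s * ∑ vertices h
  ∑-replicas f {h} e =
    trans (∑-cartesianProductWith f replica vertices (All.universal e (allFin (suc s))))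
      (cong (ℕ._* ∑ vertices h) (length-tabulate {n = suc s} (λ i → i)))

  ∑-vertices′ : ∀ (f : V′ → ℕ) {h} → (∀ i v → f (replica i v) ≡ h v) →
    ∑ vertices′ f ≡ ∑ vertices (f ∘ original) + suc s * ∑ vertices h
  ∑-vertices′ f e = trans (∑-++ f (map original vertices) replicas)
    (cong₂ _+_ (∑-map f original vertices) (∑-replicas f e))

  -- A replica vertex reaches the root through its nearest bottom node, and an original vertex
  -- reaches a bottom node through the root; hence this recursion and the next are coupled.
  rootSum-step : rootSum′ ≡ rootSum + suc s * (n + bottomSum)
  rootSum-step = trans
    (∑-vertices′ (λ v → δ′ v (original root))
      (λ i v → cong suc (trans (cong (β v ℕ.+_) (δ-refl root)) (+-identityʳ _))))
    (cong (λ x → rootSum + suc s * x) (∑-suc β vertices))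

  bottomSum-step : bottomSum′ ≡ n + rootSum + suc s * bottomSum
  bottomSum-step = trans (∑-vertices′ β′ (λ _ _ → refl))
    (cong (ℕ._+ suc s * bottomSum) (∑-suc (λ v → δ v root) vertices))

  -- The pairs of distinct replicas contribute k (k - 1) X; the term k X is moved to the
  -- left to avoid subtraction.
  pairSum-replicas : ∀ {is} → Unique is → let k = length is; X = n * (n + bottomSum) in
    sumPairs δ′ (cartesianProductWith replica is vertices) + k * X ≡ k * pairSum + k * k * X
  pairSum-replicas {[]} _ = refl
  pairSum-replicas {i ∷ is} (i∉is ∷ unique-is) = begin
    sumPairs δ′ (map (replica i) vertices ++ rest) + suc k * X
      ≡⟨ cong (ℕ._+ suc k * X) (sumPairs-++ δ′ (map (replica i) vertices) rest) ⟩
    sumPairs δ′ (map (replica i) vertices) + sumPairs δ′ rest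
      + ∑ (map (replica i) vertices) (λ x → ∑ rest (δ′ x)) + suc k * X
      ≡⟨ cong₂ (λ a b → a + sumPairs δ′ rest + b + suc k * X) within across ⟩
    pairSum + sumPairs δ′ rest + k * (X + X) + suc k * X
      ≡⟨ collect pairSum (sumPairs δ′ rest) k X ⟩
    pairSum + (sumPairs δ′ rest + k * X) + (k * (X + X) + X)
      ≡⟨ cong (λ a → pairSum + a + (k * (X + X) + X)) (pairSum-replicas unique-is) ⟩
    pairSum + (k * pairSum + k * k * X) + (k * (X + X) + X)
      ≡⟨ square pairSum k X ⟩
    suc k * pairSum + suc k * suc k * X ∎
    where
    open ≡-Reasoning
    k = length is
    X = n * (n + bottomSum)
    rest = cartesianProductWith replica is vertices

    within : sumPairs δ′ (map (replica i) vertices) ≡ pairSum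
    within = trans (sumPairs-map δ′ (replica i) vertices)
      (sumPairs-cong vertices (δʳ-diag (i Fin.≟ i)))

    -- Each of the `k` remaining replicas gives one block of pairs, to which either endpoint
    -- contributes `X`.
    across : ∑ (map (replica i) vertices) (λ x → ∑ rest (δ′ x)) ≡ k * (X + X)
    across = begin
      ∑ (map (replica i) vertices) (λ x → ∑ rest (δ′ x))
        ≡⟨ ∑-map (λ x → ∑ rest (δ′ x)) (replica i) vertices ⟩
      ∑ vertices (λ u → ∑ rest (δ′ (replica i u)))
        ≡⟨ ∑-cong vertices (λ u → ∑-cartesianProductWith (δ′ (replica i u)) replica vertices
             (All.map (λ {j} i≢j v → δʳ-off (i Fin.≟ j) i≢j u v) i∉is)) ⟩
      ∑ vertices (λ u → k * ∑ vertices (λ v → suc (β u) + suc (β v)))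
        ≡⟨ ∑-* k _ vertices ⟩
      k * ∑ vertices (λ u → ∑ vertices (λ v → suc (β u) + suc (β v)))
        ≡⟨ cong (k *_) (∑∑-+ (suc ∘ β) (suc ∘ β) vertices vertices) ⟩
      k * (n * ∑ vertices (suc ∘ β) + n * ∑ vertices (suc ∘ β))
        ≡⟨ cong (λ x → k * (n * x + n * x)) (∑-suc β vertices) ⟩
      k * (X + X) ∎

    collect : ∀ p q k x → p + q + k * (x + x) + suc k * x ≡ p + (q + k * x) + (k * (x + x) + x)
    collect = solve-∀

    square : ∀ p k x → p + (k * p + k * k * x) + (k * (x + x) + x) ≡ suc k * p + suc k * suc k * x
    square = solve-∀

  -- The cross terms are `r * n * rootSum + r * X` between original and replicas and
  -- `(r * r - r) * X` among replicas. With `X = n * (n + bottomSum)` they combine to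
  -- `r * n * rootSum′`.
  pairSum-step : pairSum′ ≡ suc (suc s) * pairSum + suc s * n * rootSum′
  pairSum-step = begin
    pairSum′
      ≡⟨ sumPairs-++ δ′ (map original vertices) replicas ⟩
    sumPairs δ′ (map original vertices) + sumPairs δ′ replicas
      + ∑ (map original vertices) (λ x → ∑ replicas (δ′ x))
      ≡⟨ cong₂ (λ a b → a + sumPairs δ′ replicas + b) (sumPairs-map δ′ original vertices) across ⟩
    pairSum + sumPairs δ′ replicas + r * (n * rootSum + X)
      ≡⟨ collect pairSum (sumPairs δ′ replicas) r (n * rootSum) X ⟩
    pairSum + (sumPairs δ′ replicas + r * X) + r * (n * rootSum)
      ≡⟨ cong (λ a → pairSum + a + r * (n * rootSum)) replicas-sum ⟩
    pairSum + (r * pairSum + r * r * X) + r * (n * rootSum)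
      ≡⟨ factor pairSum r n rootSum bottomSum ⟩
    suc r * pairSum + r * n * (rootSum + r * (n + bottomSum))
      ≡⟨ cong (λ x → suc r * pairSum + r * n * x) rootSum-step ⟨
    suc r * pairSum + r * n * rootSum′ ∎
    where
    open ≡-Reasoning
    r = suc s
    X = n * (n + bottomSum)

    across : ∑ (map original vertices) (λ x → ∑ replicas (δ′ x)) ≡ r * (n * rootSum + X)
    across = begin
      ∑ (map original vertices) (λ x → ∑ replicas (δ′ x))
        ≡⟨ ∑-map (λ x → ∑ replicas (δ′ x)) original vertices ⟩
      ∑ vertices (λ u → ∑ replicas (δ′ (original u)))
        ≡⟨ ∑-cong vertices (λ u → ∑-replicas (δ′ (original u)) (λ _ _ → refl)) ⟩
      ∑ vertices (λ u → r * ∑ vertices (λ v → δ u root + suc (β v)))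
        ≡⟨ ∑-* r _ vertices ⟩
      r * ∑ vertices (λ u → ∑ vertices (λ v → δ u root + suc (β v)))
        ≡⟨ cong (r *_) (∑∑-+ (λ u → δ u root) (suc ∘ β) vertices vertices) ⟩
      r * (n * rootSum + n * ∑ vertices (suc ∘ β))
        ≡⟨ cong (λ x → r * (n * rootSum + n * x)) (∑-suc β vertices) ⟩
      r * (n * rootSum + X) ∎

    replicas-sum : sumPairs δ′ replicas + r * X ≡ r * pairSum + r * r * X
    replicas-sum = subst (λ k → sumPairs δ′ replicas + k * X ≡ k * pairSum + k * k * X)
      (length-tabulate {n = r} (λ i → i)) (pairSum-replicas (Unique.allFin⁺ r))

    collect : ∀ p q r m x → p + q + r * (m + x) ≡ p + (q + r * x) + r * m
    collect = solve-∀

    factor : ∀ p r n h b → p + (r * p + r * r * (n * (n + b))) + r * (n * h)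
                         ≡ suc r * p + r * n * (h + r * (n + b))
    factor = solve-∀

-- Solving the recursions.

metric : ∀ s t → HubMetric (G (suc (suc s)) t)
metric s zero    = triangleMetric
metric s (suc t) = StepMetric.stepMetric s (metric s t)

module ClosedForm (s : ℕ) (z>2 : 2 ℕ.< suc (suc s)) where
  open ≡-Reasoning

  private
    r = suc s
    z = suc r
    h b d n : ℕ → ℕ
    h t = HubMetric.rootSum (metric s t)
    b t = HubMetric.bottomSum (metric s t)
    d t = HubMetric.pairSum (metric s t)
    n t = length (HubGraph.vertices (G z t))

  h-step : ∀ t → h (suc t) ≡ h t + r * (3 * z ^ t + b t)
  h-step t = subst (λ m → h (suc t) ≡ h t + r * (m + b t)) (length-vertices z z>2 t)
    (StepMetric.rootSum-step s (metric s t))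

  b-step : ∀ t → b (suc t) ≡ 3 * z ^ t + h t + r * b t
  b-step t = subst (λ m → b (suc t) ≡ m + h t + r * b t) (length-vertices z z>2 t)
    (StepMetric.bottomSum-step s (metric s t))

  d-step : ∀ t → d (suc t) ≡ z * d t + r * (3 * z ^ t) * h (suc t)
  d-step t = subst (λ m → d (suc t) ≡ z * d t + r * m * h (suc t)) (length-vertices z z>2 t)
    (StepMetric.pairSum-step s (metric s t))

  -- The matrix ((1, r), (1, r)) of the recursion for (h, b) has eigenvalues z and 0; this is
  -- its left null vector (1, -1).
  h≡b+3sz^t : ∀ t → h (suc t) ≡ b (suc t) + 3 * s * z ^ t
  h≡b+3sz^t t = begin
    h (suc t)                                        ≡⟨ h-step t ⟩
    h t + r * (3 * z ^ t + b t)                      ≡⟨ lemma s (h t) (b t) (z ^ t) ⟩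
    3 * z ^ t + h t + r * b t + 3 * s * z ^ t        ≡⟨ cong (ℕ._+ 3 * s * z ^ t) (b-step t) ⟨
    b (suc t) + 3 * s * z ^ t                        ∎
    where
    lemma : ∀ s h b Z → h + suc s * (3 * Z + b) ≡ 3 * Z + h + suc s * b + 3 * s * Z
    lemma = solve-∀

  -- The null vector relation turns the recursion into `h (2 + t) = z * h (1 + t) + 6 * r * z ^ t`.
  -- The forcing term grows at the rate of the eigenvalue `z`, which produces the factor `t`;
  -- scaling by `z` avoids a division.
  zh-closed : ∀ t → z * h (suc t) ≡ z ^ t * (z * (2 + 4 * r) + 6 * r * t)
  -- In the triangle the root distances sum to 2 and `β` sums to 1.
  zh-closed zero    = trans (cong (z *_) (h-step 0)) (lemma s)
    where
    lemma : ∀ s → let r = suc s; z = suc r in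
      z * (2 + r * (3 * 1 + 1)) ≡ 1 * (z * (2 + 4 * r) + 6 * r * 0)
    lemma = solve-∀
  zh-closed (suc t) = begin
    z * h (suc (suc t))
      ≡⟨ cong (z *_) (trans (h-step (suc t)) (cong (ℕ._+ r * (3 * (z * Z) + b₁)) (h≡b+3sz^t t))) ⟩
    z * (b₁ + 3 * s * Z + r * (3 * (z * Z) + b₁))
      ≡⟨ expand s b₁ Z ⟩
    z * (z * (b₁ + 3 * s * Z)) + 6 * r * (z * Z)
      ≡⟨ cong (λ x → z * (z * x) + 6 * r * (z * Z)) (h≡b+3sz^t t) ⟨
    z * (z * h (suc t)) + 6 * r * (z * Z)
      ≡⟨ cong (λ x → z * x + 6 * r * (z * Z)) (zh-closed t) ⟩
    z * (Z * (z * (2 + 4 * r) + 6 * r * t)) + 6 * r * (z * Z)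
      ≡⟨ collect z r t Z ⟩
    z * Z * (z * (2 + 4 * r) + 6 * r * suc t) ∎
    where
    Z = z ^ t
    b₁ = b (suc t)
    expand : ∀ s b₁ Z → let r = suc s; z = suc r in
      z * (b₁ + 3 * s * Z + r * (3 * (z * Z) + b₁)) ≡ z * (z * (b₁ + 3 * s * Z)) + 6 * r * (z * Z)
    expand = solve-∀
    collect : ∀ z r t Z → z * (Z * (z * (2 + 4 * r) + 6 * r * t)) + 6 * r * (z * Z)
                        ≡ z * Z * (z * (2 + 4 * r) + 6 * r * suc t)
    collect = solve-∀

  -- The root sums drive `d-step` at order `t * z ^ (2 * t)`, and the homogeneous solution is a
  -- multiple of `Z`. Scaled by `z * z`, with the negative term moved to the left, the identity
  -- stays in the naturals.
  d-closed : ∀ t → let Z = z ^ t in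
    z * z * d t + 12 * s * z * Z ≡ 18 * r * t * (Z * Z) + 3 * z * z * Z + 12 * s * z * (Z * Z)
  -- The triangle has three pairs at distance 1.
  d-closed zero    = lemma s
    where
    lemma : ∀ s → let r = suc s; z = suc r in
      z * z * 3 + 12 * s * z * 1 ≡ 18 * r * 0 * 1 + 3 * z * z * 1 + 12 * s * z * 1
    lemma = solve-∀
  d-closed (suc t) = begin
    z * z * d (suc t) + 12 * s * z * (z * Z)
      ≡⟨ cong (λ x → z * z * x + 12 * s * z * (z * Z)) (d-step t) ⟩
    z * z * (z * d t + r * (3 * Z) * h (suc t)) + 12 * s * z * (z * Z)
      ≡⟨ expand z r s (d t) (h (suc t)) Z ⟩
    z * (z * z * d t + 12 * s * z * Z) + 3 * r * z * Z * (z * h (suc t))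
      ≡⟨ cong₂ (λ x y → z * x + 3 * r * z * Z * y) (d-closed t) (zh-closed t) ⟩
    z * (18 * r * t * (Z * Z) + 3 * z * z * Z + 12 * s * z * (Z * Z))
      + 3 * r * z * Z * (Z * (z * (2 + 4 * r) + 6 * r * t))
      ≡⟨ collect s t Z ⟩
    18 * r * suc t * (z * Z * (z * Z)) + 3 * z * z * (z * Z) + 12 * s * z * (z * Z * (z * Z)) ∎
    where
    Z = z ^ t
    expand : ∀ z r s d h Z → z * z * (z * d + r * (3 * Z) * h) + 12 * s * z * (z * Z)
      ≡ z * (z * z * d + 12 * s * z * Z) + 3 * r * z * Z * (z * h)
    expand = solve-∀
    collect : ∀ s t Z → let r = suc s; z = suc r in
      z * (18 * r * t * (Z * Z) + 3 * z * z * Z + 12 * s * z * (Z * Z))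
        + 3 * r * z * Z * (Z * (z * (2 + 4 * r) + 6 * r * t))
      ≡ 18 * r * suc t * (z * Z * (z * Z)) + 3 * z * z * (z * Z) + 12 * s * z * (z * Z * (z * Z))
    collect = solve-∀

-- Bounding the deviation from the limit.

-- Lets an error of order `t * z ^ t` be absorbed into `z ^ (2 * t)`.
n≤z^n : ∀ s n → n ≤ suc (suc s) ^ n
n≤z^n s zero    = z≤n
n≤z^n s (suc n) = ≤-<-trans (n≤z^n s n) (^-monoʳ-< (suc (suc s)) (s≤s (s≤s z≤n)) (n<1+n n))

-- Scaled by z² P t, the deviation of the t-th term from the limit is the number e below.
deviation : ∀ s t d Z .{{_ : ℕ.NonZero Z}} → t ≤ Z → let r = suc s; z = suc r; P = 3 * Z * (3 * Z ∸ 1) in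
  z * z * d + 12 * s * z * Z ≡ 18 * r * t * (Z * Z) + 3 * z * z * Z + 12 * s * z * (Z * Z) →
  ∃ λ e → 2 * d * z ^ 2 ≡ 4 * r * (P * t) + e × e ≤ (12 * r + 6 * z * z + 24 * s * z) * P
deviation s t d Z@(suc k) t≤Z closed = e , equation , bound
  where
  r = suc s
  z = suc r
  P = 3 * Z * (3 * Z ∸ 1)
  -- Twice the closed form has leading term `36 * r * t * Z * Z`, and `4 * r * P * t` falls short of
  -- it by the first summand. The other two are twice the lower-order terms of `z²d`.
  e = 12 * r * t * Z + 6 * z * z * Z + 24 * s * z * Z * k

  -- Since `Z` is `suc k`, the two terms in `12 * s * z` combine without subtraction.
  z²d : z * z * d ≡ 18 * r * t * (Z * Z) + 3 * z * z * Z + 12 * s * z * Z * k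
  z²d = +-cancelʳ-≡ (12 * s * z * Z) _ _ (trans closed (lemma r t z s k))
    where
    lemma : ∀ r t z s k → let Z = suc k in
      18 * r * t * (Z * Z) + 3 * z * z * Z + 12 * s * z * (Z * Z)
      ≡ 18 * r * t * (Z * Z) + 3 * z * z * Z + 12 * s * z * Z * k + 12 * s * z * Z
    lemma = solve-∀

  equation : 2 * d * z ^ 2 ≡ 4 * r * (P * t) + e
  equation = begin
    2 * d * z ^ 2     ≡⟨ lemma₁ d z ⟩
    2 * (z * z * d)   ≡⟨ cong (2 *_) z²d ⟩
    2 * (18 * r * t * (Z * Z) + 3 * z * z * Z + 12 * s * z * Z * k) ≡⟨ lemma₂ r t z s k ⟩
    4 * r * (P * t) + e ∎
    where
    open ≡-Reasoning
    lemma₁ : ∀ d z → 2 * d * (z * (z * 1)) ≡ 2 * (z * z * d)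
    lemma₁ = solve-∀
    -- `k + (Z + (Z + 0))` is what `3 * Z ∸ 1` computes to.
    lemma₂ : ∀ r t z s k → let Z = suc k in
      2 * (18 * r * t * (Z * Z) + 3 * z * z * Z + 12 * s * z * Z * k)
      ≡ 4 * r * (3 * Z * (k + (Z + (Z + 0))) * t)
        + (12 * r * t * Z + 6 * z * z * Z + 24 * s * z * Z * k)
    lemma₂ = solve-∀

  bound : e ≤ (12 * r + 6 * z * z + 24 * s * z) * P
  bound = begin
    12 * r * t * Z + 6 * z * z * Z + 24 * s * z * Z * k
      -- Every term becomes a multiple of `Z * Z`, by `t ≤ Z`, `1 ≤ Z` and `k ≤ Z`.
      ≤⟨ +-mono-≤ (+-mono-≤ (*-monoˡ-≤ Z (*-monoʳ-≤ (12 * r) t≤Z))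
                            (m≤m*n (6 * z * z * Z) Z))
                  (*-monoʳ-≤ (24 * s * z * Z) (n≤1+n k)) ⟩
    12 * r * Z * Z + 6 * z * z * Z * Z + 24 * s * z * Z * Z
      ≡⟨ lemma r z s Z ⟩
    (12 * r + 6 * z * z + 24 * s * z) * (Z * Z)
      -- `Z * Z ≤ P` because `Z` is at most both `3 * Z` and `3 * Z ∸ 1`.
      ≤⟨ *-monoʳ-≤ (12 * r + 6 * z * z + 24 * s * z)
           (*-mono-≤ (m≤n*m Z 3) (≤-trans (m≤m+n Z (Z + 0)) (m≤n+m _ k))) ⟩
    (12 * r + 6 * z * z + 24 * s * z) * P ∎
    where
    open ≤-Reasoning
    lemma : ∀ r z s Z → 12 * r * Z * Z + 6 * z * z * Z * Z + 24 * s * z * Z * Z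
                      ≡ (12 * r + 6 * z * z + 24 * s * z) * (Z * Z)
    lemma = solve-∀

-- Rational arithmetic and the limit.

-- The difference is exactly `e / (y * b)`, hence nonnegative. As `b` and `suc m` are at least 1, it
-- suffices that `e / y` is below `1 / suc q`.
∣-∣<-intro : ∀ x y a b e m q .{{_ : ℕ.NonZero y}} .{{_ : ℕ.NonZero b}} →
  x * b ≡ a * y + e → e * suc q ℕ.< y →
  ℚ.∣ + x / y ℚ.- + a / b ∣ ℚ.< ℚ.mkℚᵘ ℤ.+[1+ m ] q
∣-∣<-intro x (suc y) a (suc b) e m q x*b≡ e*q<y =
  ℚ.*<* (subst₂ ℤ._<_ numerator (ℤ.pos-* (suc m) (suc y * suc b)) (ℤ.+<+ bound))
  where
  difference : + x ℤ.* + suc b ℤ.+ ℤ.- (+ a) ℤ.* + suc y ≡ + e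
  difference = begin
    + x ℤ.* + suc b ℤ.+ ℤ.- (+ a) ℤ.* + suc y
      ≡⟨ cong₂ ℤ._+_ (sym (ℤ.pos-* x (suc b)))
           (trans (sym (ℤ.neg-distribˡ-* (+ a) (+ suc y))) (cong ℤ.-_ (sym (ℤ.pos-* a (suc y))))) ⟩
    + (x * suc b) ℤ.- + (a * suc y)
      ≡⟨ cong (λ k → + k ℤ.- + (a * suc y)) (trans x*b≡ (+-comm (a * suc y) e)) ⟩
    + (e + a * suc y) ℤ.- + (a * suc y)
      ≡⟨ ℤ.+-assoc (+ e) (+ (a * suc y)) (ℤ.- + (a * suc y)) ⟩
    + e ℤ.+ (+ (a * suc y) ℤ.- + (a * suc y))
      ≡⟨ cong (ℤ._+_ (+ e)) (ℤ.+-inverseʳ (+ (a * suc y))) ⟩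
    + e ℤ.+ + 0
      ≡⟨ ℤ.+-identityʳ (+ e) ⟩
    + e ∎
    where open ≡-Reasoning
  numerator : + (e * suc q) ≡ + ℤ.∣ + x ℤ.* + suc b ℤ.+ ℤ.- (+ a) ℤ.* + suc y ∣ ℤ.* + suc q
  numerator = trans (ℤ.pos-* e (suc q)) (cong (λ i → + ℤ.∣ i ∣ ℤ.* + suc q) (sym difference))
  bound : e * suc q ℕ.< suc m * (suc y * suc b)
  bound = <-≤-trans e*q<y (≤-trans (m≤m*n (suc y) (suc b)) (m≤n*m (suc y * suc b) (suc m)))

-- Both sides are the same unnormalised fraction, not merely equal in value, so `subst` can exchange
-- them inside the limit.
÷-half-÷ : ∀ d p t .{{_ : ℕ.NonZero p}} .{{_ : ℕ.NonZero t}} →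
  (+ d / 1 ÷ (+ p / 2)) ÷ (+ t / 1) ≡ (+ (2 * d) / (p * t)) {{m*n≢0 p t}}
÷-half-÷ d (suc p) (suc t) = cong₂ ℚ.mkℚᵘ
  (trans (ℤ.*-identityʳ (+ d ℤ.* + 2)) (trans (sym (ℤ.pos-* d 2)) (cong +_ (*-comm d 2))))
  (cong (λ k → t + k * suc t) (+-identityʳ p))

theorem3p7 : (z : ℕ) (z>2 : 2 ℕ.< z) →
    (λ t → averagePathLength z z>2 t ÷ (+ t / 1)) ⟶ ((+ (4 ℕ.* (z ∸ 1)) / (z ℕ.^ 2)) {{z^n≢0 z>2 2}})
theorem3p7 (suc zero) (s≤s ())
theorem3p7 z@(suc (suc s)) z>2 (ℚ.mkℚᵘ (+ zero) q) (ℚ.*<* (ℤ.+<+ ()))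
theorem3p7 z@(suc (suc s)) z>2 (ℚ.mkℚᵘ ℤ.-[1+ m ] q) (ℚ.*<* ())
-- With `e ≤ K * P`, every `t` above `K * suc q` satisfies `e * suc q < P * t`; the outer `suc` of
-- the threshold makes this strict.
theorem3p7 z@(suc r@(suc s)) z>2 (ℚ.mkℚᵘ ℤ.+[1+ m ] q) _ = suc (K * suc q) , close
  where
  K = 12 * r + 6 * z * z + 24 * s * z
  ℓ = (+ (4 * r) / (z ^ 2)) {{z^n≢0 z>2 2}}

  close : ∀ t → .{{_ : ℕ.NonZero t}} → suc (K * suc q) ≤ t →
    ℚ.∣ averagePathLength z z>2 t ÷ (+ t / 1) ℚ.- ℓ ∣ ℚ.< ℚ.mkℚᵘ ℤ.+[1+ m ] q
  close t T≤t = subst (λ x → ℚ.∣ x ℚ.- ℓ ∣ ℚ.< ℚ.mkℚᵘ ℤ.+[1+ m ] q) (sym (÷-half-÷ (D z t) P t {{P≢0}}))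
    (∣-∣<-intro (2 * D z t) (P * t) (4 * r) (z ^ 2) e m q {{m*n≢0 P t {{P≢0}}}} {{z^n≢0 z>2 2}} equation small)
    where
    P = N z t * (N z t ∸ 1)
    P≢0 : ℕ.NonZero P
    P≢0 = N[N-1]≢0 z>2 t
    d≡ : D z t ≡ HubMetric.pairSum (metric s t)
    d≡ = HubMetric.totalDistance≡pairSum (metric s t) (connected z t)
    dev = deviation s t (D z t) (z ^ t) {{z^n≢0 z>2 t}} (n≤z^n s t)
      (trans (cong (λ d → z * z * d + 12 * s * z * z ^ t) d≡) (ClosedForm.d-closed s z>2 t))
    e = proj₁ dev
    equation = proj₁ (proj₂ dev)
    small : e * suc q ℕ.< P * t
    small = begin-strict
      e * suc q       ≤⟨ *-monoˡ-≤ (suc q) (proj₂ (proj₂ dev)) ⟩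
      K * P * suc q   ≡⟨ cong (ℕ._* suc q) (*-comm K P) ⟩
      P * K * suc q   ≡⟨ *-assoc P K (suc q) ⟩
      P * (K * suc q) <⟨ *-monoʳ-< P {{P≢0}} T≤t ⟩
      P * t           ∎
      where open ≤-Reasoning
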